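{- Let $\Psi$ be a $\mathsf{Max\text{ - }2AND}$ instance with $m\ge1$ clauses and $\mathrm{bias}(\Psi)\le m/3$. Then $$\mathrm{val}_\Psi\ \ge\ \frac m4+\frac{\mathrm{bias}(\Psi)^2}{4\,(m-2\,\mathrm{bias}(\Psi))}\ \ge\ \frac{2\,(m+\mathrm{bias}(\Psi))}{9}.$$
   Context: A $\mathsf{Max\text{ - }2AND}$ instance $\Psi$ consists of Boolean variables $x_1,\dots,x_n$ and a list of $m$ clauses, each a conjunction of exactly two, not necessarily distinct, literals (a clause consisting of a single literal $\ell$ is written as $\ell\wedge\ell$). No clause is unsatisfiable, i.e. no clause has the form $x_i\wedge\neg x_i$. $\mathrm{val}_\Psi$ is the maximum over all assignments of the number of satisfied clauses. Let $\mathrm{pos}_i(\Psi)$ and $\mathrm{neg}_i(\Psi)$ be the numbers of occurrences of the literals $x_i$ and $\neg x_i$ in the clauses of $\Psi$, counted with multiplicity (so $x_i\wedge x_i$ contributes $2$ to $\mathrm{pos}_i$). Then $$\mathrm{bias}(\Psi)=\frac12\sum_{i=1}^n|\mathrm{pos}_i(\Psi)-\mathrm{neg}_i(\Psi)|.$$ -}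

module Defs where

open import Data.Bool.Base using (Bool; true; false; not; _∧_)
open import Data.Fin.Base using (Fin)
import Data.Fin.Properties as Fin
import Data.Integer.Base as ℤ
open import Data.List.Base as List using (List)
open import Data.List.Extrema.Nat using (max; argmax-sel; xs≤max)
open import Data.List.Membership.Propositional using (_∈_)
open import Data.List.Membership.Propositional.Properties
  using (∈-map⁺; ∈-map⁻; ∈-++⁺ˡ; ∈-++⁺ʳ)
open import Data.List.Relation.Unary.All as All using ()
open import Data.List.Relation.Unary.Any using (here)
open import Data.Nat.Base as ℕ using (ℕ; zero; suc; ∣_-_∣)
open import Data.Nat.Properties using (≤-antisym)
open import Data.Product.Base using (∃; _×_; _,_)
open import Data.Rational.Base hiding (∣_∣)
open import Data.Rational.Properties hiding (≤-antisym)
open import Data.Rational.Solver using (module +-*-Solver)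
open import Data.Sum.Base using (inj₁; inj₂)
open import Data.Vec.Base as Vec using (Vec; []; _∷_)
open import Function.Base using (id)
open import Relation.Binary.Definitions using (DecidableEquality)
open import Relation.Binary.PropositionalEquality
open import Relation.Nullary.Decidable using (yes; no)

ι : ℕ → ℚ
ι k = ℤ.+ k / 1

data Literal (n : ℕ) : Set where
  var ¬var : Fin n → Literal n

negate : ∀ {n} → Literal n → Literal n
negate (var i) = ¬var i
negate (¬var i) = var i

infix 4 _≟ˡ_
_≟ˡ_ : ∀ {n} → DecidableEquality (Literal n)
var i ≟ˡ var j with i Fin.≟ j
... | yes refl = yes refl
... | no  i≢j  = no λ { refl → i≢j refl }
var i ≟ˡ ¬var j = no λ ()
¬var i ≟ˡ var j = no λ ()
¬var i ≟ˡ ¬var j with i Fin.≟ j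
... | yes refl = yes refl
... | no  i≢j  = no λ { refl → i≢j refl }

-- The two literals may coincide but may not be complementary.
record Clause (n : ℕ) : Set where
  field
    first second     : Literal n
    noncomplementary : second ≢ negate first

literals : ∀ {n} → Clause n → Vec (Literal n) 2
literals c = Clause.first c ∷ Clause.second c ∷ []

-- n variables, m clauses (with repetition allowed).
Max2AND : (n m : ℕ) → Set
Max2AND n m = Vec (Clause n) m

Assignment : ℕ → Set
Assignment n = Vec Bool n

evalLiteral : ∀ {n} → Assignment n → Literal n → Bool
evalLiteral σ (var i) = Vec.lookup σ i
evalLiteral σ (¬var i) = not (Vec.lookup σ i)

evalClause : ∀ {n} → Assignment n → Clause n → Bool
evalClause σ c = evalLiteral σ (Clause.first c) ∧ evalLiteral σ (Clause.second c)

satisfied : ∀ {n m} → Max2AND n m → Assignment n → ℕ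
satisfied Ψ σ = Vec.countᵇ (evalClause σ) Ψ

allAssignments : ∀ n → List (Assignment n)
allAssignments zero    = List.[ [] ]
allAssignments (suc n) =
  List.map (true ∷_) (allAssignments n) List.++ List.map (false ∷_) (allAssignments n)

-- The default value 0 of `max` is harmless: see val-upper and val-attained.
val : ∀ {n m} → Max2AND n m → ℕ
val {n} Ψ = max 0 (List.map (satisfied Ψ) (allAssignments n))

occurrences : ∀ {n m} → Literal n → Max2AND n m → ℕ
occurrences l Ψ = Vec.count (l ≟ˡ_) (Vec.concat (Vec.map literals Ψ))

bias : ∀ {n m} → Max2AND n m → ℚ
bias Ψ = ½ * ι (Vec.sum (Vec.tabulate λ i → ∣ occurrences (var i) Ψ - occurrences (¬var i) Ψ ∣))

∈-allAssignments : ∀ {n} (σ : Assignment n) → σ ∈ allAssignments n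
∈-allAssignments []          = here refl
∈-allAssignments (true ∷ σ)  = ∈-++⁺ˡ (∈-map⁺ (true ∷_) (∈-allAssignments σ))
∈-allAssignments (false ∷ σ) =
  ∈-++⁺ʳ (List.map (true ∷_) (allAssignments _)) (∈-map⁺ (false ∷_) (∈-allAssignments σ))

val-upper : ∀ {n m} (Ψ : Max2AND n m) (σ : Assignment n) → satisfied Ψ σ ℕ.≤ val Ψ
val-upper Ψ σ = All.lookup (xs≤max 0 _) (∈-map⁺ (satisfied Ψ) (∈-allAssignments σ))

val-attained : ∀ {n m} (Ψ : Max2AND n m) → ∃ λ σ → val Ψ ≡ satisfied Ψ σ
val-attained {n} Ψ with argmax-sel id 0 (List.map (satisfied Ψ) (allAssignments n))
... | inj₂ val∈ with σ , _ , eq ← ∈-map⁻ (satisfied Ψ) val∈ = σ , eq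
... | inj₁ val≡0 = σ₀ , ≤-antisym
        (subst (ℕ._≤ satisfied Ψ σ₀) (sym val≡0) ℕ.z≤n) (val-upper Ψ σ₀)
  where
  σ₀ : Assignment n
  σ₀ = Vec.replicate n true

4[m-2b]-nonZero : ∀ (m : ℕ) (b : ℚ) → 1 ℕ.≤ m → b ≤ ι m ÷ ι 3 →
                  NonZero (ι 4 * (ι m - ι 2 * b))
4[m-2b]-nonZero m@(suc k) b _ b≤m/3 = >-nonZero (<-≤-trans 0<s (subst (s ≤_) regroup s≤))
  where
  open +-*-Solver
  s t : ℚ
  s = ι 4 * (ι m ÷ ι 3)
  t = ι m ÷ ι 3
  instance
    _ : Positive (ι m)
    _ = normalize-pos (suc k) 1
  0<s : 0ℚ < s
  0<s = positive⁻¹ s {{pos*pos⇒pos (ι 4) t {{pos*pos⇒pos (ι m) (1/ ι 3)}}}}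
  s≤ : s ≤ s + ι 8 * (t - b)
  s≤ = subst (_≤ s + ι 8 * (t - b)) (+-identityʳ s)
         (+-monoʳ-≤ s (subst (_≤ ι 8 * (t - b)) (*-zeroʳ (ι 8))
           (*-monoˡ-≤-nonNeg (ι 8) (subst (_≤ t - b) (+-inverseʳ b)
             (+-monoˡ-≤ (- b) b≤m/3)))))
  regroup : s + ι 8 * (t - b) ≡ ι 4 * (ι m - ι 2 * b)
  regroup = solve 2 (λ M B →
      con (ι 4) :* (M :* con (1/ ι 3)) :+ con (ι 8) :* (M :* con (1/ ι 3) :- B)
      := con (ι 4) :* (M :- con (ι 2) :* B)) refl (ι m) b

-- Let s i = ±1 be the majority sign of x_i and set x_i independently to true with probability
-- ½ + s i γ.  A literal l then holds with probability ½ + s(l) γ, where s(¬x_i) = - s(x_i), and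
-- since (1 - s(l)) (1 - s(l′)) ≥ 0 a clause l ∧ l′ holds with probability at least
--   ¼ - γ² + (γ / 2 + γ²) (s(l) + s(l′)).
-- The scores s(l) of all literal occurrences add up to 2 bias, so the expected number of satisfied
-- clauses is at least m/4 + γ bias - γ² (m - 2 bias).  This is maximised at
-- γ = bias / (2 (m - 2 bias)), which is at most ½ exactly when bias ≤ m/3.
{-# OPTIONS --safe #-}
module Submission where

open import Defs
open import Algebra.Bundles using (CommutativeRing)
open import Data.Bool.Base using (Bool; true; false; not; if_then_else_; _∧_)
open import Data.Bool.Properties using (T?)
open import Data.Fin.Base using (Fin; zero; suc)
import Data.Fin.Properties as Fin
import Data.Integer.Base as ℤ
import Data.Integer.Properties as ℤ
open import Data.Nat.Base as ℕ using (ℕ; zero; suc; ∣_-_∣)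
import Data.Nat.Properties as ℕ
open import Data.Product.Base using (_×_; _,_)
open import Data.Rational.Base hiding (∣_∣)
open import Data.Rational.Properties
open import Data.Rational.Solver using (module +-*-Solver)
import Data.Rational.Unnormalised.Base as ℚᵘ
import Data.Rational.Unnormalised.Properties as ℚᵘ
open import Data.Sum.Base using (_⊎_; inj₁; inj₂; [_,_]′)
open import Data.Vec.Base as Vec using (Vec; []; _∷_)
open import Function.Base using (_∘_)
open import Relation.Binary.PropositionalEquality
open import Relation.Nullary.Decidable using (does; yes; no)
open import Relation.Nullary.Negation using (contradiction)
open import Relation.Unary using (Decidable)

open import Algebra.Properties.Semiring.Sum (CommutativeRing.semiring +-*-commutativeRing)
  using (sum; sum-cong-≗; ∑-distrib-+; sum-replicate-zero)
open +-*-Solver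

private
  variable
    n m : ℕ
    p q r : ℚ

-- Rational arithmetic

p≤q⇒0≤q-p : p ≤ q → 0ℚ ≤ q - p
p≤q⇒0≤q-p {p} {q} p≤q = subst (_≤ q - p) (+-inverseʳ p) (+-monoˡ-≤ (- p) p≤q)

-- The form in which most inequalities here are proved: a nonnegative slack `r` is exhibited, and an
-- identity is left to the ring solver.
p+r≡q⇒p≤q : 0ℚ ≤ r → p + r ≡ q → p ≤ q
p+r≡q⇒p≤q {r} {p} {q} 0≤r p+r≡q = subst₂ _≤_ (+-identityʳ p) p+r≡q (+-monoʳ-≤ p 0≤r)

0≤p*q : 0ℚ ≤ p → 0ℚ ≤ q → 0ℚ ≤ p * q
0≤p*q {p} {q} 0≤p 0≤q = nonNegative⁻¹ (p * q)
  {{nonNeg*nonNeg⇒nonNeg p {{nonNegative 0≤p}} q {{nonNegative 0≤q}}}}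

0≤p*p : ∀ p → 0ℚ ≤ p * p
0≤p*p p with ≤-total 0ℚ p
... | inj₁ 0≤p = 0≤p*q 0≤p 0≤p
... | inj₂ p≤0 = subst (0ℚ ≤_) (solve 1 (λ p → (:- p) :* (:- p) := p :* p) refl p)
                   (0≤p*q (neg-antimono-≤ p≤0) (neg-antimono-≤ p≤0))

-- Because 1/p = (1/p)² p, a product of a square and a nonnegative number.
0≤1/p : ∀ p .{{_ : NonZero p}} → 0ℚ ≤ p → 0ℚ ≤ 1/ p
0≤1/p p {{p≢0}} 0≤p = subst (0ℚ ≤_)
  (trans (*-assoc (1/ p) (1/ p) p)
    (trans (cong (1/ p *_) (*-inverseˡ p)) (*-identityʳ (1/ p))))
  (0≤p*q (0≤p*p (1/ p)) 0≤p)

-- `ι` normalises by a gcd, which is stuck on open terms. In the unnormalised rationals both sides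
-- have denominator 1 and the claim is integer arithmetic.
ι-homo-+ : ∀ a b → ι (a ℕ.+ b) ≡ ι a + ι b
ι-homo-+ a b = toℚᵘ-injective (begin
  toℚᵘ (ι (a ℕ.+ b))                    ≈⟨ toℚᵘ-fromℚᵘ _ ⟩
  ℚᵘ.mkℚᵘ (ℤ.+ (a ℕ.+ b)) 0             ≈⟨ ℚᵘ.*≡* (cong (ℤ._* ℤ.+ 1)
    (sym (cong₂ ℤ._+_ (ℤ.*-identityʳ (ℤ.+ a)) (ℤ.*-identityʳ (ℤ.+ b))))) ⟩
  ℚᵘ.mkℚᵘ (ℤ.+ a) 0 ℚᵘ.+ ℚᵘ.mkℚᵘ (ℤ.+ b) 0
    ≈⟨ ℚᵘ.+-cong (toℚᵘ-fromℚᵘ (ℚᵘ.mkℚᵘ (ℤ.+ a) 0)) (toℚᵘ-fromℚᵘ (ℚᵘ.mkℚᵘ (ℤ.+ b) 0)) ⟨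
  toℚᵘ (ι a) ℚᵘ.+ toℚᵘ (ι b)            ≈⟨ toℚᵘ-homo-+ (ι a) (ι b) ⟨
  toℚᵘ (ι a + ι b)                      ∎)
  where
  open ℚᵘ.≃-Reasoning

ι-mono-≤ : ∀ {a b} → a ℕ.≤ b → ι a ≤ ι b
ι-mono-≤ {a} {b} a≤b = p+r≡q⇒p≤q (nonNegative⁻¹ (ι (b ℕ.∸ a)) {{normalize-nonNeg (b ℕ.∸ a) 1}})
  (trans (sym (ι-homo-+ a (b ℕ.∸ a))) (cong ι (ℕ.m+[n∸m]≡n a≤b)))

ι-∸ : ∀ {a b} → b ℕ.≤ a → ι (a ℕ.∸ b) ≡ ι a - ι b
ι-∸ {a} {b} b≤a = begin
  ι (a ℕ.∸ b)                ≡⟨ solve 2 (λ x y → x := y :+ x :- y) refl (ι (a ℕ.∸ b)) (ι b) ⟩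
  ι b + ι (a ℕ.∸ b) - ι b    ≡⟨ cong (_- ι b) (ι-homo-+ b (a ℕ.∸ b)) ⟨
  ι (b ℕ.+ (a ℕ.∸ b)) - ι b  ≡⟨ cong (λ k → ι k - ι b) (ℕ.m+[n∸m]≡n b≤a) ⟩
  ι a - ι b                  ∎
  where open ≡-Reasoning

ι-sum : ∀ (f : Fin n → ℕ) → ι (Vec.sum (Vec.tabulate f)) ≡ sum (ι ∘ f)
ι-sum {zero} f = refl
ι-sum {suc n} f = trans (ι-homo-+ (f zero) _) (cong (ι (f zero) +_) (ι-sum (f ∘ suc)))

χ : Bool → ℚ
χ b = if b then 1ℚ else 0ℚ

χ-∧ : ∀ a b → χ (a ∧ b) ≡ χ a * χ b
χ-∧ true  b = sym (*-identityˡ (χ b))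
χ-∧ false b = sym (*-zeroˡ (χ b))

χ-∧-idem : ∀ b → χ (b ∧ b) ≡ χ b
χ-∧-idem true  = refl
χ-∧-idem false = refl

ι-count : ∀ {A : Set} {P : A → Set} (P? : Decidable P) x (xs : Vec A n) →
          ι (Vec.count P? (x ∷ xs)) ≡ χ (does (P? x)) + ι (Vec.count P? xs)
ι-count P? x xs with does (P? x)
... | true  = ι-homo-+ 1 (Vec.count P? xs)
... | false = sym (+-identityˡ _)

-- Product distributions

Probability : ℚ → Set
Probability p = 0ℚ ≤ p × p ≤ 1ℚ

-- The slack is p (1 - p). This handles clauses `l ∧ l`, which hold with probability p rather than
-- p².
p*p≤p : ∀ p → Probability p → p * p ≤ p
p*p≤p p (0≤p , p≤1) = p+r≡q⇒p≤q (0≤p*q 0≤p (p≤q⇒0≤q-p p≤1))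
  (solve 1 (λ p → p :* p :+ p :* (con 1ℚ :- p) := p) refl p)

mean : ℚ → (Bool → ℚ) → ℚ
mean p g = p * g true + (1ℚ - p) * g false

mean-const : ∀ p c → mean p (λ _ → c) ≡ c
mean-const = solve 2 (λ p c → p :* c :+ (con 1ℚ :- p) :* c := c) refl

mean-cong : ∀ p {f g : Bool → ℚ} → f ≗ g → mean p f ≡ mean p g
mean-cong p f≗g = cong₂ (λ x y → p * x + (1ℚ - p) * y) (f≗g true) (f≗g false)

mean-+ : ∀ p f g → mean p (λ b → f b + g b) ≡ mean p f + mean p g
mean-+ p f g = solve 5 (λ p a b c d →
    p :* (a :+ b) :+ (con 1ℚ :- p) :* (c :+ d)
    := (p :* a :+ (con 1ℚ :- p) :* c) :+ (p :* b :+ (con 1ℚ :- p) :* d))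
  refl p (f true) (g true) (f false) (g false)

mean-*ˡ : ∀ p c f → mean p (λ b → c * f b) ≡ c * mean p f
mean-*ˡ p c f = solve 4 (λ p c a b →
    p :* (c :* a) :+ (con 1ℚ :- p) :* (c :* b) := c :* (p :* a :+ (con 1ℚ :- p) :* b))
  refl p c (f true) (f false)

mean-mono : Probability p → ∀ {f g} → (∀ b → f b ≤ g b) → mean p f ≤ mean p g
mean-mono {p} (0≤p , p≤1) f≤g = +-mono-≤
  (*-monoˡ-≤-nonNeg p {{nonNegative 0≤p}} (f≤g true))
  (*-monoˡ-≤-nonNeg (1ℚ - p) {{nonNegative (p≤q⇒0≤q-p p≤1)}} (f≤g false))

-- Expectation over independent bits, bit `i` being true with probability `P i`. Averaging one
-- coordinate at a time lets every property follow by induction from the one-bit `mean`.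
𝔼 : (Fin n → ℚ) → (Assignment n → ℚ) → ℚ
𝔼 {zero}  P f = f []
𝔼 {suc n} P f = mean (P zero) λ b → 𝔼 (P ∘ suc) λ σ → f (b ∷ σ)

𝔼-const : ∀ (P : Fin n → ℚ) c → 𝔼 P (λ _ → c) ≡ c
𝔼-const {zero}  P c = refl
𝔼-const {suc n} P c = trans (mean-cong (P zero) λ _ → 𝔼-const (P ∘ suc) c) (mean-const (P zero) c)

𝔼-cong : ∀ (P : Fin n → ℚ) {f g} → f ≗ g → 𝔼 P f ≡ 𝔼 P g
𝔼-cong {zero}  P f≗g = f≗g []
𝔼-cong {suc n} P f≗g = mean-cong (P zero) λ b → 𝔼-cong (P ∘ suc) λ σ → f≗g (b ∷ σ)

𝔼-+ : ∀ (P : Fin n → ℚ) f g → 𝔼 P (λ σ → f σ + g σ) ≡ 𝔼 P f + 𝔼 P g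
𝔼-+ {zero}  P f g = refl
𝔼-+ {suc n} P f g = trans (mean-cong (P zero) λ b → 𝔼-+ (P ∘ suc) (f ∘ (b ∷_)) (g ∘ (b ∷_)))
  (mean-+ (P zero) (λ b → 𝔼 (P ∘ suc) (f ∘ (b ∷_))) (λ b → 𝔼 (P ∘ suc) (g ∘ (b ∷_))))

𝔼-*ˡ : ∀ (P : Fin n → ℚ) c f → 𝔼 P (λ σ → c * f σ) ≡ c * 𝔼 P f
𝔼-*ˡ {zero}  P c f = refl
𝔼-*ˡ {suc n} P c f = trans (mean-cong (P zero) λ b → 𝔼-*ˡ (P ∘ suc) c (f ∘ (b ∷_)))
  (mean-*ˡ (P zero) c (λ b → 𝔼 (P ∘ suc) (f ∘ (b ∷_))))

𝔼-mono : ∀ {P : Fin n → ℚ} → (∀ i → Probability (P i)) → ∀ {f g} →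
         (∀ σ → f σ ≤ g σ) → 𝔼 P f ≤ 𝔼 P g
𝔼-mono {zero}  _    f≤g = f≤g []
𝔼-mono {suc n} prob f≤g =
  mean-mono (prob zero) λ b → 𝔼-mono (prob ∘ suc) λ σ → f≤g (b ∷ σ)

𝔼-lookup : ∀ (P : Fin n → ℚ) i (g : Bool → ℚ) → 𝔼 P (λ σ → g (Vec.lookup σ i)) ≡ mean (P i) g
𝔼-lookup P zero    g = mean-cong (P zero) λ b → 𝔼-const (P ∘ suc) (g b)
𝔼-lookup P (suc i) g =
  trans (mean-cong (P zero) λ _ → 𝔼-lookup (P ∘ suc) i g) (mean-const (P zero) _)

-- If one index is the leading coordinate, its factor is constant for the inner expectation and can
-- be pulled out. If neither is, the leading coordinate is averaged over a constant.
𝔼-independent : ∀ (P : Fin n → ℚ) {i j} → i ≢ j → ∀ (g h : Bool → ℚ) →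
  𝔼 P (λ σ → g (Vec.lookup σ i) * h (Vec.lookup σ j)) ≡ mean (P i) g * mean (P j) h
𝔼-independent P {zero} {zero} i≢j g h = contradiction refl i≢j
𝔼-independent P {zero} {suc j} i≢j g h = begin
  mean (P zero) (λ b → 𝔼 (P ∘ suc) λ σ → g b * h (Vec.lookup σ j))
    ≡⟨ mean-cong (P zero) (λ b → trans (𝔼-*ˡ (P ∘ suc) (g b) _)
         (trans (cong (g b *_) (𝔼-lookup (P ∘ suc) j h)) (*-comm (g b) _))) ⟩
  mean (P zero) (λ b → mean (P (suc j)) h * g b)
    ≡⟨ mean-*ˡ (P zero) (mean (P (suc j)) h) g ⟩
  mean (P (suc j)) h * mean (P zero) g
    ≡⟨ *-comm (mean (P (suc j)) h) _ ⟩
  mean (P zero) g * mean (P (suc j)) h  ∎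
  where open ≡-Reasoning
𝔼-independent P {suc i} {zero} i≢j g h =
  trans (𝔼-cong P λ σ → *-comm (g (Vec.lookup σ (suc i))) (h (Vec.lookup σ zero)))
    (trans (𝔼-independent P (i≢j ∘ sym) h g) (*-comm (mean (P zero) h) (mean (P (suc i)) g)))
𝔼-independent P {suc i} {suc j} i≢j g h =
  trans (mean-cong (P zero) λ _ → 𝔼-independent (P ∘ suc) (i≢j ∘ cong suc) g h)
    (mean-const (P zero) _)

-- Literals and clauses under a product distribution

variable-of : Literal n → Fin n
variable-of (var i)  = i
variable-of (¬var i) = i

polarity : Literal n → Bool → Bool
polarity (var _)  b = b
polarity (¬var _) b = not b

evalLiteral≡polarity : ∀ σ (l : Literal n) →
                       evalLiteral σ l ≡ polarity l (Vec.lookup σ (variable-of l))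
evalLiteral≡polarity σ (var i)  = refl
evalLiteral≡polarity σ (¬var i) = refl

-- Noncomplementarity excludes opposite polarities, so a clause on a single variable repeats one
-- literal.
same-variable : ∀ {l l′ : Literal n} → l′ ≢ negate l → variable-of l ≡ variable-of l′ → l ≡ l′
same-variable {l = var i}  {var j}  _ i≡j = cong var i≡j
same-variable {l = var i}  {¬var j} l′≢¬l i≡j = contradiction (cong ¬var (sym i≡j)) l′≢¬l
same-variable {l = ¬var i} {var j}  l′≢¬l i≡j = contradiction (cong var (sym i≡j)) l′≢¬l
same-variable {l = ¬var i} {¬var j} _ i≡j = cong ¬var i≡j

ℙ : (Fin n → ℚ) → Literal n → ℚ
ℙ P l = mean (P (variable-of l)) (χ ∘ polarity l)

ℙ-probability : ∀ {P : Fin n → ℚ} → (∀ i → Probability (P i)) → ∀ l → Probability (ℙ P l)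
ℙ-probability {P = P} prob l =
  subst (_≤ ℙ P l) (mean-const (P i) 0ℚ) (mean-mono (prob i) (0≤χ ∘ polarity l)) ,
  subst (ℙ P l ≤_) (mean-const (P i) 1ℚ) (mean-mono (prob i) (χ≤1 ∘ polarity l))
  where
  i = variable-of l
  0≤χ : ∀ b → 0ℚ ≤ χ b
  0≤χ true  = nonNegative⁻¹ 1ℚ
  0≤χ false = ≤-refl
  χ≤1 : ∀ b → χ b ≤ 1ℚ
  χ≤1 true  = ≤-refl
  χ≤1 false = nonNegative⁻¹ 1ℚ

-- Distinct variables are independent and give equality. Otherwise the literals coincide, and the
-- clause holds with probability p ≥ p².
𝔼-evalClause : ∀ {P : Fin n → ℚ} → (∀ i → Probability (P i)) → ∀ c →
  ℙ P (Clause.first c) * ℙ P (Clause.second c) ≤ 𝔼 P (λ σ → χ (evalClause σ c))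
𝔼-evalClause {P = P} prob record { first = l ; second = l′ ; noncomplementary = l′≢¬l }
  with variable-of l Fin.≟ variable-of l′
... | no i≢j = ≤-reflexive (sym (trans
        (𝔼-cong P λ σ → trans
          (cong₂ (λ a b → χ (a ∧ b)) (evalLiteral≡polarity σ l) (evalLiteral≡polarity σ l′))
          (χ-∧ (polarity l _) (polarity l′ _)))
        (𝔼-independent P i≢j (χ ∘ polarity l) (χ ∘ polarity l′))))
... | yes i≡j with refl ← same-variable l′≢¬l i≡j = begin
  ℙ P l * ℙ P l                                    ≤⟨ p*p≤p (ℙ P l) (ℙ-probability prob l) ⟩
  ℙ P l                                            ≡⟨ 𝔼-lookup P (variable-of l) (χ ∘ polarity l) ⟨
  𝔼 P (λ σ → χ (polarity l (Vec.lookup σ (variable-of l))))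
    ≡⟨ 𝔼-cong P (λ σ → trans (χ-∧-idem _) (cong χ (evalLiteral≡polarity σ l))) ⟨
  𝔼 P (λ σ → χ (evalLiteral σ l ∧ evalLiteral σ l))  ∎
  where open ≤-Reasoning

𝔼-satisfied-∷ : ∀ (P : Fin n → ℚ) c (Ψ : Max2AND n m) →
  𝔼 P (λ σ → ι (satisfied (c ∷ Ψ) σ))
  ≡ 𝔼 P (λ σ → χ (evalClause σ c)) + 𝔼 P (λ σ → ι (satisfied Ψ σ))
-- `countᵇ` unfolds to `count` with `T?`, whose `does` is the Boolean itself.
𝔼-satisfied-∷ P c Ψ = trans (𝔼-cong P λ σ → ι-count (T? ∘ evalClause σ) c Ψ)
  (𝔼-+ P (λ σ → χ (evalClause σ c)) (λ σ → ι (satisfied Ψ σ)))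

-- An average cannot exceed the maximum.
𝔼-satisfied≤val : ∀ {P : Fin n → ℚ} → (∀ i → Probability (P i)) → (Ψ : Max2AND n m) →
                  𝔼 P (λ σ → ι (satisfied Ψ σ)) ≤ ι (val Ψ)
𝔼-satisfied≤val {P = P} prob Ψ = subst (𝔼 P (λ σ → ι (satisfied Ψ σ)) ≤_)
  (𝔼-const P (ι (val Ψ))) (𝔼-mono prob λ σ → ι-mono-≤ (val-upper Ψ σ))

-- Signs and scores

score : (Fin n → ℚ) → Literal n → ℚ
score s (var i)  = s i
score s (¬var i) = - s i

totalScore : (Fin n → ℚ) → Vec (Literal n) m → ℚ
totalScore s []      = 0ℚ
totalScore s (l ∷ L) = score s l + totalScore s L

Sign : ℚ → Set
Sign s = s ≡ 1ℚ ⊎ s ≡ - 1ℚ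

score≤1 : ∀ {s : Fin n → ℚ} → (∀ i → Sign (s i)) → ∀ l → score s l ≤ 1ℚ
score≤1 sign (var i) with sign i
... | inj₁ eq rewrite eq = ≤-refl
... | inj₂ eq rewrite eq = *≤* ℤ.-≤+
score≤1 sign (¬var i) with sign i
... | inj₁ eq rewrite eq = *≤* ℤ.-≤+
... | inj₂ eq rewrite eq = ≤-refl

sum-indicator : ∀ (s : Fin n → ℚ) j → sum (λ i → s i * χ (does (i Fin.≟ j))) ≡ s j
sum-indicator {suc n} s zero = trans
  (cong₂ _+_ (*-identityʳ (s zero))
    (trans (sum-cong-≗ λ i → *-zeroʳ (s (suc i))) (sum-replicate-zero n)))
  (+-identityʳ (s zero))
sum-indicator s (suc j) = trans
  (cong₂ _+_ (*-zeroʳ (s zero)) (sum-indicator (s ∘ suc) j))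
  (+-identityˡ (s (suc j)))

-- `_≟ˡ_` is defined by a `with` on `i Fin.≟ j`, so its `does` reduces only after the same case
-- split.
does-var≟var : ∀ (i j : Fin n) → does (var i ≟ˡ var j) ≡ does (i Fin.≟ j)
does-var≟var i j with i Fin.≟ j
... | yes refl = refl
... | no  _    = refl

does-¬var≟¬var : ∀ (i j : Fin n) → does (¬var i ≟ˡ ¬var j) ≡ does (i Fin.≟ j)
does-¬var≟¬var i j with i Fin.≟ j
... | yes refl = refl
... | no  _    = refl

sum-score : ∀ (s : Fin n → ℚ) l →
  sum (λ i → s i * (χ (does (var i ≟ˡ l)) - χ (does (¬var i ≟ˡ l)))) ≡ score s l
sum-score s (var j) = trans
  -- Literals of opposite polarity compare as `false` by computation, so the second indicator is
  -- already 0.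
  (sum-cong-≗ λ i → cong (s i *_) (trans (+-identityʳ _) (cong χ (does-var≟var i j))))
  (sum-indicator s j)
sum-score s (¬var j) = trans
  (sum-cong-≗ λ i → trans
    (cong (λ b → s i * (0ℚ - χ b)) (does-¬var≟¬var i j))
    (solve 2 (λ s x → s :* (con 0ℚ :- x) := (:- s) :* x) refl (s i) (χ (does (i Fin.≟ j)))))
  (sum-indicator (λ i → - s i) j)

signedCount : (Fin n → ℚ) → Vec (Literal n) m → Fin n → ℚ
signedCount s L i = s i * (ι (Vec.count (var i ≟ˡ_) L) - ι (Vec.count (¬var i ≟ˡ_) L))

-- Double counting: the left side groups the scores by variable, the right side lists them by
-- occurrence.
sum-signedCount : ∀ (s : Fin n → ℚ) (L : Vec (Literal n) m) →
                  sum (signedCount s L) ≡ totalScore s L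
sum-signedCount {n} s [] = trans (sum-cong-≗ λ i → *-zeroʳ (s i)) (sum-replicate-zero n)
sum-signedCount s (l ∷ L) = begin
  sum (signedCount s (l ∷ L))
    ≡⟨ sum-cong-≗ (λ i → trans
         (cong₂ (λ x y → s i * (x - y)) (ι-count (var i ≟ˡ_) l L) (ι-count (¬var i ≟ˡ_) l L))
         (solve 5 (λ s a b c d →
             s :* (a :+ b :- (c :+ d)) := s :* (a :- c) :+ s :* (b :- d))
           refl (s i) (χ (does (var i ≟ˡ l))) (ι (Vec.count (var i ≟ˡ_) L))
             (χ (does (¬var i ≟ˡ l))) (ι (Vec.count (¬var i ≟ˡ_) L)))) ⟩
  sum (λ i → s i * (χ (does (var i ≟ˡ l)) - χ (does (¬var i ≟ˡ l))) + signedCount s L i)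
    ≡⟨ ∑-distrib-+ _ (signedCount s L) ⟩
  sum (λ i → s i * (χ (does (var i ≟ˡ l)) - χ (does (¬var i ≟ˡ l)))) + sum (signedCount s L)
    ≡⟨ cong₂ _+_ (sum-score s l) (sum-signedCount s L) ⟩
  totalScore s (l ∷ L)  ∎
  where open ≡-Reasoning

-- Majority signs and the bias

majority : ℕ → ℕ → ℚ
-- On a tie either sign would do, since the difference it multiplies is 0.
majority a b = [ (λ _ → 1ℚ) , (λ _ → - 1ℚ) ]′ (ℕ.≤-total b a)

majority-sign : ∀ a b → Sign (majority a b)
majority-sign a b with ℕ.≤-total b a
... | inj₁ _ = inj₁ refl
... | inj₂ _ = inj₂ refl

majority-abs : ∀ a b → majority a b * (ι a - ι b) ≡ ι ∣ a - b ∣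
majority-abs a b with ℕ.≤-total b a
... | inj₁ b≤a = trans (*-identityˡ _)
        (sym (trans (cong ι (ℕ.m≤n⇒∣n-m∣≡n∸m b≤a)) (ι-∸ b≤a)))
... | inj₂ a≤b = trans (solve 2 (λ x y → con (- 1ℚ) :* (x :- y) := y :- x) refl (ι a) (ι b))
        (sym (trans (cong ι (ℕ.m≤n⇒∣m-n∣≡n∸m a≤b)) (ι-∸ a≤b)))

allLiterals : (Ψ : Max2AND n m) → Vec (Literal n) (m ℕ.* 2)
allLiterals Ψ = Vec.concat (Vec.map literals Ψ)

majoritySign : Max2AND n m → Fin n → ℚ
majoritySign Ψ i = majority (occurrences (var i) Ψ) (occurrences (¬var i) Ψ)

-- The majority sign turns each pos - neg into its absolute value. The sum of these is twice the
-- bias, which carries a factor ½.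
totalScore-majoritySign : ∀ (Ψ : Max2AND n m) →
                          totalScore (majoritySign Ψ) (allLiterals Ψ) ≡ bias Ψ + bias Ψ
totalScore-majoritySign Ψ = begin
  totalScore (majoritySign Ψ) (allLiterals Ψ)         ≡⟨ sum-signedCount _ (allLiterals Ψ) ⟨
  sum (signedCount (majoritySign Ψ) (allLiterals Ψ))
    ≡⟨ sum-cong-≗ {x = signedCount (majoritySign Ψ) (allLiterals Ψ)} (λ i →
         majority-abs (occurrences (var i) Ψ) (occurrences (¬var i) Ψ)) ⟩
  sum (ι ∘ difference)                                ≡⟨ ι-sum difference ⟨
  ι (Vec.sum (Vec.tabulate difference))
    ≡⟨ solve 1 (λ x → x := con ½ :* x :+ con ½ :* x) refl (ι (Vec.sum (Vec.tabulate difference))) ⟩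
  bias Ψ + bias Ψ                                     ∎
  where
  open ≡-Reasoning
  difference = λ i → ∣ occurrences (var i) Ψ - occurrences (¬var i) Ψ ∣

-- The biased assignment

module _ (γ : ℚ) (s : Fin n → ℚ) (sign : ∀ i → Sign (s i)) where

  biased : Fin n → ℚ
  biased i = ½ + s i * γ

  ℙ-biased : ∀ l → ℙ biased l ≡ ½ + score s l * γ
  ℙ-biased (var i)  = solve 2 (λ s γ →
    (con ½ :+ s :* γ) :* con 1ℚ :+ (con 1ℚ :- (con ½ :+ s :* γ)) :* con 0ℚ
    := con ½ :+ s :* γ) refl (s i) γ
  ℙ-biased (¬var i) = solve 2 (λ s γ →
    (con ½ :+ s :* γ) :* con 0ℚ :+ (con 1ℚ :- (con ½ :+ s :* γ)) :* con 1ℚ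
    := con ½ :+ (:- s) :* γ) refl (s i) γ

  biased-probability : 0ℚ ≤ γ → γ ≤ ½ → ∀ i → Probability (biased i)
  biased-probability 0≤γ γ≤½ i with sign i
  ... | inj₁ eq rewrite eq =
    p+r≡q⇒p≤q (+-mono-≤ (nonNegative⁻¹ ½) 0≤γ)
      (solve 1 (λ γ → con 0ℚ :+ (con ½ :+ γ) := con ½ :+ con 1ℚ :* γ) refl γ) ,
    p+r≡q⇒p≤q (p≤q⇒0≤q-p γ≤½)
      (solve 1 (λ γ → (con ½ :+ con 1ℚ :* γ) :+ (con ½ :- γ) := con 1ℚ) refl γ)
  ... | inj₂ eq rewrite eq =
    p+r≡q⇒p≤q (p≤q⇒0≤q-p γ≤½)
      (solve 1 (λ γ → con 0ℚ :+ (con ½ :- γ) := con ½ :+ con (- 1ℚ) :* γ) refl γ) ,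
    p+r≡q⇒p≤q (+-mono-≤ (nonNegative⁻¹ ½) 0≤γ)
      (solve 1 (λ γ → (con ½ :+ con (- 1ℚ) :* γ) :+ (con ½ :+ γ) := con 1ℚ) refl γ)

  -- The argument is the sum of the two scores in a clause. Being affine in it, the bounds of all
  -- clauses add up to an expression in the total score alone.
  clauseBound : ℚ → ℚ
  clauseBound t = ½ * ½ - γ * γ + (½ * γ + γ * γ) * t

  -- The slack is γ² (1 - a) (1 - b) for scores a and b, both at most 1.
  clauseBound≤ℙ*ℙ : ∀ l l′ → clauseBound (score s l + score s l′) ≤ ℙ biased l * ℙ biased l′
  clauseBound≤ℙ*ℙ l l′ rewrite ℙ-biased l | ℙ-biased l′ = p+r≡q⇒p≤q
    (0≤p*q (0≤p*p γ) (0≤p*q (p≤q⇒0≤q-p (score≤1 sign l)) (p≤q⇒0≤q-p (score≤1 sign l′))))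
    (solve 3 (λ γ a b →
        con ½ :* con ½ :- γ :* γ :+ (con ½ :* γ :+ γ :* γ) :* (a :+ b)
          :+ γ :* γ :* ((con 1ℚ :- a) :* (con 1ℚ :- b))
        := (con ½ :+ a :* γ) :* (con ½ :+ b :* γ))
      refl γ (score s l) (score s l′))

  𝔼-satisfied≥ : 0ℚ ≤ γ → γ ≤ ½ → (Ψ : Max2AND n m) →
    ι m * (½ * ½ - γ * γ) + (½ * γ + γ * γ) * totalScore s (allLiterals Ψ)
    ≤ 𝔼 biased (λ σ → ι (satisfied Ψ σ))
  𝔼-satisfied≥ 0≤γ γ≤½ [] = ≤-reflexive (trans
    (solve 1 (λ γ → con 0ℚ :* (con ½ :* con ½ :- γ :* γ) :+ (con ½ :* γ :+ γ :* γ) :* con 0ℚ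
                    := con 0ℚ) refl γ)
    (sym (𝔼-const biased 0ℚ)))
  𝔼-satisfied≥ {m = suc m} 0≤γ γ≤½ (c ∷ Ψ) = begin
    ι (suc m) * (½ * ½ - γ * γ) + (½ * γ + γ * γ) * (a + (b + t))
      ≡⟨ cong (λ x → x * (½ * ½ - γ * γ) + (½ * γ + γ * γ) * (a + (b + t))) (ι-homo-+ 1 m) ⟩
    (1ℚ + ι m) * (½ * ½ - γ * γ) + (½ * γ + γ * γ) * (a + (b + t))
      ≡⟨ solve 5 (λ M γ a b t →
           (con 1ℚ :+ M) :* (con ½ :* con ½ :- γ :* γ)
             :+ (con ½ :* γ :+ γ :* γ) :* (a :+ (b :+ t))
           := (con ½ :* con ½ :- γ :* γ :+ (con ½ :* γ :+ γ :* γ) :* (a :+ b))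
             :+ (M :* (con ½ :* con ½ :- γ :* γ) :+ (con ½ :* γ :+ γ :* γ) :* t))
           refl (ι m) γ a b t ⟩
    clauseBound (a + b) + (ι m * (½ * ½ - γ * γ) + (½ * γ + γ * γ) * t)
      ≤⟨ +-mono-≤
           (≤-trans (clauseBound≤ℙ*ℙ l l′) (𝔼-evalClause (biased-probability 0≤γ γ≤½) c))
           (𝔼-satisfied≥ 0≤γ γ≤½ Ψ) ⟩
    𝔼 biased (λ σ → χ (evalClause σ c)) + 𝔼 biased (λ σ → ι (satisfied Ψ σ))
      ≡⟨ 𝔼-satisfied-∷ biased c Ψ ⟨
    𝔼 biased (λ σ → ι (satisfied (c ∷ Ψ) σ))  ∎
    where
    open ≤-Reasoning
    l = Clause.first c
    l′ = Clause.second c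
    a = score s l
    b = score s l′
    t = totalScore s (allLiterals Ψ)

-- The biased assignment with majority signs, for any admissible γ; its total score is twice the
-- bias.
val≥ : ∀ (Ψ : Max2AND n m) {γ} → 0ℚ ≤ γ → γ ≤ ½ →
  ι m * (½ * ½ - γ * γ) + (½ * γ + γ * γ) * (bias Ψ + bias Ψ) ≤ ι (val Ψ)
val≥ {m = m} Ψ {γ} 0≤γ γ≤½ = subst
  (λ t → ι m * (½ * ½ - γ * γ) + (½ * γ + γ * γ) * t ≤ ι (val Ψ))
  (totalScore-majoritySign Ψ)
  (≤-trans (𝔼-satisfied≥ γ s sign 0≤γ γ≤½ Ψ)
    (𝔼-satisfied≤val (biased-probability γ s sign 0≤γ γ≤½) Ψ))
  where
  s = majoritySign Ψ
  sign : ∀ i → Sign (s i)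
  sign i = majority-sign (occurrences (var i) Ψ) (occurrences (¬var i) Ψ)

-- The optimal γ and the comparison of the two bounds

0≤bias : ∀ (Ψ : Max2AND n m) → 0ℚ ≤ bias Ψ
0≤bias {n} Ψ = 0≤p*q {q = ι total} (nonNegative⁻¹ ½) (ι-mono-≤ {0} {total} ℕ.z≤n)
  where
  total = Vec.sum (Vec.tabulate {n = n} λ i → ∣ occurrences (var i) Ψ - occurrences (¬var i) Ψ ∣)

lemma3p3 : ∀ {n m : ℕ} (Ψ : Max2AND n m) (m≥1 : m ℕ.≥ 1) (bias≤m/3 : bias Ψ ≤ ι m ÷ ι 3) →
    let b = bias Ψ
        bound = ι m ÷ ι 4
                + _÷_ (b * b) (ι 4 * (ι m - ι 2 * b)) {{4[m-2b]-nonZero m b m≥1 bias≤m/3}}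
    in (ι (val Ψ) ≥ bound) × (bound ≥ (ι 2 * (ι m + b)) ÷ ι 9)
lemma3p3 {n} {m} Ψ m≥1 bias≤m/3 = lower , upper
  where
  M b N u γ : ℚ
  M = ι m
  b = bias Ψ
  N = ι 4 * (M - ι 2 * b)
  instance
    N≢0 : NonZero N
    N≢0 = 4[m-2b]-nonZero m b m≥1 bias≤m/3
  u = 1/ N
  -- As N = 4 (M - 2 b), this is b / (2 (M - 2 b)), the maximiser of M/4 + γ b - γ² (M - 2 b).
  γ = ι 2 * b * u

  0≤M/3-b : 0ℚ ≤ M * 1/ ι 3 - b
  0≤M/3-b = p≤q⇒0≤q-p bias≤m/3

  0≤u : 0ℚ ≤ u
  -- N = 12 (M/3 - b) + 4 b, a sum of nonnegative terms.
  0≤u = 0≤1/p N (subst (0ℚ ≤_)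
    (solve 2 (λ M b → con (ι 12) :* (M :* con (1/ ι 3) :- b) :+ con (ι 4) :* b
       := con (ι 4) :* (M :- con (ι 2) :* b)) refl M b)
    (+-mono-≤ (0≤p*q (nonNegative⁻¹ (ι 12)) 0≤M/3-b) (0≤p*q (nonNegative⁻¹ (ι 4)) (0≤bias Ψ))))

  -- The ring solver treats `u` as a free variable, so `u * N` = 1 is applied by hand. The
  -- polynomial identities below are arranged to display the factor `u * N`.
  cancel : ∀ x → x * (u * N) ≡ x
  cancel x = trans (cong (x *_) (*-inverseˡ N)) (*-identityʳ x)

  0≤γ : 0ℚ ≤ γ
  0≤γ = 0≤p*q (0≤p*q (nonNegative⁻¹ (ι 2)) (0≤bias Ψ)) 0≤u

  γ≤½ : γ ≤ ½
  -- The slack ½ - γ equals 6 (M/3 - b) u; nonnegativity of M/3 - b is the hypothesis on the bias.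
  γ≤½ = p+r≡q⇒p≤q (0≤p*q (0≤p*q (nonNegative⁻¹ (ι 6)) 0≤M/3-b) 0≤u)
    (trans
      (solve 3 (λ M b u → con (ι 2) :* b :* u :+ con (ι 6) :* (M :* con (1/ ι 3) :- b) :* u
         := con ½ :* (u :* (con (ι 4) :* (M :- con (ι 2) :* b)))) refl M b u)
      (cancel ½))

  lower : M * 1/ ι 4 + b * b * u ≤ ι (val Ψ)
  lower = subst (_≤ ι (val Ψ)) expected (val≥ Ψ 0≤γ γ≤½)
    where
    open ≡-Reasoning
    expected : M * (½ * ½ - γ * γ) + (½ * γ + γ * γ) * (b + b) ≡ M * 1/ ι 4 + b * b * u
    expected = begin
      M * (½ * ½ - γ * γ) + (½ * γ + γ * γ) * (b + b)
        -- The linear term γ b is 2 b² u, and the quadratic term γ² (M - 2 b) is b² u (u N), which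
        -- is half as large.
        ≡⟨ solve 3 (λ M b u → let γ = con (ι 2) :* b :* u in
             M :* (con ½ :* con ½ :- γ :* γ) :+ (con ½ :* γ :+ γ :* γ) :* (b :+ b)
             := M :* con (1/ ι 4) :+ con (ι 2) :* (b :* b :* u)
               :- b :* b :* u :* (u :* (con (ι 4) :* (M :- con (ι 2) :* b)))) refl M b u ⟩
      M * 1/ ι 4 + ι 2 * (b * b * u) - b * b * u * (u * N)
        ≡⟨ cong (λ x → M * 1/ ι 4 + ι 2 * (b * b * u) - x) (cancel (b * b * u)) ⟩
      M * 1/ ι 4 + ι 2 * (b * b * u) - b * b * u
        ≡⟨ solve 2 (λ x y → x :+ con (ι 2) :* y :- y := x :+ y) refl (M * 1/ ι 4) (b * b * u) ⟩
      M * 1/ ι 4 + b * b * u  ∎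

  -- The difference of the two sides is (M - 5 b)² / (9 N).
  upper : ι 2 * (M + b) * 1/ ι 9 ≤ M * 1/ ι 4 + b * b * u
  upper = p+r≡q⇒p≤q
    (0≤p*q (0≤p*q (nonNegative⁻¹ (1/ ι 9)) (0≤p*p (M - ι 5 * b))) 0≤u)
    (begin
      ι 2 * (M + b) * 1/ ι 9 + 1/ ι 9 * ((M - ι 5 * b) * (M - ι 5 * b)) * u
        ≡⟨ cong (_+ 1/ ι 9 * ((M - ι 5 * b) * (M - ι 5 * b)) * u) (cancel (ι 2 * (M + b) * 1/ ι 9)) ⟨
      ι 2 * (M + b) * 1/ ι 9 * (u * N) + 1/ ι 9 * ((M - ι 5 * b) * (M - ι 5 * b)) * u
        ≡⟨ solve 3 (λ M b u →
             con (ι 2) :* (M :+ b) :* con (1/ ι 9) :* (u :* (con (ι 4) :* (M :- con (ι 2) :* b)))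
               :+ con (1/ ι 9) :* ((M :- con (ι 5) :* b) :* (M :- con (ι 5) :* b)) :* u
             := M :* con (1/ ι 4) :* (u :* (con (ι 4) :* (M :- con (ι 2) :* b)))
               :+ b :* b :* u) refl M b u ⟩
      M * 1/ ι 4 * (u * N) + b * b * u
        ≡⟨ cong (_+ b * b * u) (cancel (M * 1/ ι 4)) ⟩
      M * 1/ ι 4 + b * b * u  ∎)
    where open ≡-Reasoning
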